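{- The naïve LZD construction algorithm and the naïve LZMW construction algorithm each take $\Omega(n^{5/4})$ time in the worst case; that is, for arbitrarily large $n$ there are input strings of length $n$ (over an alphabet whose size may grow with $n$) on which the algorithm runs in time $\Omega(n^{5/4})$.
   Context: LZD parsing of $s[1..n]$: $s=p_1\cdots p_z$, where with $k=|p_1\cdots p_{i-1}|+1$, $p_i=p_{i_1}p_{i_2}$ with $p_{i_1}$ the longest prefix of $s[k..n]$ in $\{p_1,\dots,p_{i-1}\}\cup\Sigma$ and $p_{i_2}$ the longest prefix of $s[k+|p_{i_1}|..n]$ in that set. LZMW parsing: $p_i$ is the longest prefix of $s[k..n]$ in $\{p_jp_{j+1}:1\le j\le i-2\}\cup\Sigma$. The naïve LZD algorithm maintains a compacted trie (edge labels stored as pairs of positions into the input, which is accessible by random access) containing the phrases computed so far and the distinct letters seen so far, with the nodes of these strings marked. To find each component $p_{i_1}$ (resp. $p_{i_2}$) starting at position $j$, it traverses the trie from the root, comparing letters of $s[j..n]$ with edge labels, as far as the match extends, and takes the string of the lowest marked node on the matched path (if nothing matches, the letter $s[j]$ is inserted as a new marked child of the root). After computing $p_i$, it inserts $p_i$ into the trie by traversing from the root along $p_i$, creating at most two nodes, and marking the node of $p_i$. The naïve LZMW algorithm is identical except that when computing $p_i$ the trie contains (marked) the strings $p_1p_2,\dots,p_{i-2}p_{i-1}$ (and the letters), and one longest marked match is taken per phrase. The running time counts all letter comparisons and trie-node steps. -}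

module Defs where

open import Data.Nat using (ℕ; zero; suc; _+_; _*_; _^_; _≤_; _⊔_; _≡ᵇ_)
open import Data.Nat.Properties using (_≟_)
open import Data.List using (List; []; _∷_; length; _++_; take; drop)
open import Data.Bool using (Bool; true; false; if_then_else_)
open import Data.Maybe using (Maybe; just; nothing)
open import Data.Product using (∃-syntax; _×_)
open import Relation.Nullary using (yes; no)

-- Strings over the alphabet ℕ (an unbounded alphabet, so its size may grow with n).
Word : Set
Word = List ℕ

lcp : Word → Word → ℕ
lcp (a ∷ u) (b ∷ v) with a ≟ b
... | yes _ = suc (lcp u v)
... | no  _ = 0
lcp _ _ = 0

isPrefix : Word → Word → Bool
isPrefix d w = lcp d w ≡ᵇ length d

-- The trie is represented by the list of its marked strings.
-- Depth reached when traversing the trie from the root along w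
-- (= longest prefix of w that is a prefix of some stored string).
matchDepth : List Word → Word → ℕ
matchDepth []      w = 0
matchDepth (d ∷ D) w = lcp d w ⊔ matchDepth D w

-- Length of the string of the lowest marked node on the matched path
-- (= longest stored string that is a prefix of w).
longestMarked : List Word → Word → ℕ
longestMarked []      w = 0
longestMarked (d ∷ D) w = (if isPrefix d w then length d else 0) ⊔ longestMarked D w

record SearchResult : Set where
  constructor mkRes
  field
    len  : ℕ
    trie : List Word
    cost : ℕ
open SearchResult public

-- One search from the current position (remaining input w).
-- Cost = letters matched + 1 (the final comparison / node step).
-- If nothing matches, the letter w[1] is inserted as a new marked child of the root
-- (cost one extra step) and the factor is that letter.
search : List Word → Word → SearchResult
search T []      = mkRes 0 T 0
search T (a ∷ w) with matchDepth T (a ∷ w)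
... | zero  = mkRes 1 ((a ∷ []) ∷ T) 2
... | suc m = mkRes (1 ⊔ longestMarked T (a ∷ w)) T (suc (suc m))

-- Naive LZD: fuel, trie contents (phrases + letters), remaining input ↦ total cost.
-- Inserting the phrase p_i costs |p_i| steps.
lzdRun : ℕ → List Word → Word → ℕ
lzdRun zero    T w       = 0
lzdRun (suc f) T []      = 0
lzdRun (suc f) T (a ∷ w) = cost r1 + cost r2 + length p + lzdRun f (p ∷ trie r2) (drop l (a ∷ w))
  where
  r1 = search T (a ∷ w)
  r2 = search (trie r1) (drop (len r1) (a ∷ w))
  l  = len r1 + len r2
  p  = take l (a ∷ w)

lzdCost : Word → ℕ
lzdCost s = lzdRun (length s) [] s

-- Naive LZMW: fuel, trie contents (p_1p_2, …, p_{i-2}p_{i-1} + letters),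
-- previous phrase, remaining input ↦ total cost.
-- After computing p_i, p_{i-1}p_i is inserted at cost |p_{i-1}p_i|.
insertPair : Maybe Word → Word → List Word → List Word
insertPair nothing  p T = T
insertPair (just q) p T = (q ++ p) ∷ T

insertCost : Maybe Word → Word → ℕ
insertCost nothing  p = 0
insertCost (just q) p = length (q ++ p)

lzmwRun : ℕ → List Word → Maybe Word → Word → ℕ
lzmwRun zero    T prev w       = 0
lzmwRun (suc f) T prev []      = 0
lzmwRun (suc f) T prev (a ∷ w) =
  cost r + insertCost prev p + lzmwRun f (insertPair prev p (trie r)) (just p) (drop (len r) (a ∷ w))
  where
  r = search T (a ∷ w)
  p = take (len r) (a ∷ w)

lzmwCost : Word → ℕ
lzmwCost s = lzmwRun (length s) [] nothing s

-- cost(s) = Ω(|s|^{5/4}) on inputs of arbitrarily large length: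
-- there is a constant C such that for every N there is an input s with |s| ≥ N
-- and |s|^5 ≤ C · cost(s)^4  (i.e. cost(s) ≥ C^{-1/4} |s|^{5/4}).
OmegaN54 : (Word → ℕ) → Set
OmegaN54 c = ∃[ C ] (∀ (N : ℕ) → ∃[ s ] (N ≤ length s × length s ^ 5 ≤ C * c s ^ 4))

{-# OPTIONS --safe #-}
module Submission where

open import Defs
open import Data.Bool using (true; false)
open import Data.Empty using (⊥; ⊥-elim)
open import Data.List using (List; []; _∷_; length; _++_; take; drop; replicate)
open import Data.List.Membership.Propositional using (_∈_)
open import Data.List.Membership.Propositional.Properties using (∈-++⁺ʳ; ∈-++⁻)
open import Data.List.Properties using (length-++; length-replicate; ++-assoc; ∷-injectiveˡ; ∷-injectiveʳ)
open import Data.List.Relation.Unary.All using (All; []; _∷_)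
import Data.List.Relation.Unary.All as All
import Data.List.Relation.Unary.All.Properties as All
open import Data.List.Relation.Unary.Any using (here; there)
open import Data.Maybe using (Maybe; just; nothing)
open import Data.Nat
open import Data.Nat.Properties
open import Data.Nat.Tactic.RingSolver using (solve-∀)
open import Data.Product using (_×_; _,_; proj₁; proj₂; ∃-syntax)
open import Data.Unit using (⊤)
open import Data.Sum using (_⊎_; inj₁; inj₂; map₁)
open import Relation.Binary.PropositionalEquality hiding (J)
open import Relation.Nullary using (yes; no; ¬_)

-- One string of length O(k³) makes both algorithms spend Ω(k⁴), so that cost ≥ c·n^{4/3}.
-- Let u = 0 1 2 … (kℓ - 1) be a word of distinct letters, cut into k blocks of length ℓ = 3k + 3, and let
-- $ be the letter kℓ.  The input is a sequence of factors of u$, each followed by two letters that occur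
-- nowhere else; hence only dictionary strings that are factors [x, y) of u$ ever matter.
--
-- Setup.  For the start x of every block, u[x..]$ is put in the dictionary, although no other string
-- starting at x is.  A search at x in a later copy of u (without $) then descends to the end of u, while
-- the longest marked string on its path is short.
--
-- Stages t = 1, …, k.  Short factors put [x, x + 3t) in the dictionary, for every block start x; then comes a
-- copy of u.  With x′ the start of the next block, it is parsed x → x+3t → x+3t+1 → x+3t+2 → x′: the setup
-- has stored the last piece, and the letters at x+3t and x+3t+1 have not yet started a dictionary string.
-- So each stage searches at all k block starts, which costs Ω(k · kℓ) letters for a copy of length kℓ.
-- The longest short string at x has grown only from 3t to 3t + 1 letters, so there is room for k stages.
--
-- LZD and LZMW are treated at once: the pieces are the same in both parsings, LZD stores the concatenations
-- of the pairs of pieces (1,2), (3,4), …, and LZMW those of all adjacent pieces.  It is enough that every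
-- piece is a letter or stored by LZD, and that LZMW has stored no longer match.

-- Runs of consecutive letters, and searches in the trie.

run : ℕ → ℕ → Word
run x zero    = []
run x (suc n) = x ∷ run (suc x) n

length-run : ∀ x n → length (run x n) ≡ n
length-run x zero    = refl
length-run x (suc n) = cong suc (length-run (suc x) n)

length-run-++ : ∀ x n v → length (run x n ++ v) ≡ n + length v
length-run-++ x n v = trans (length-++ (run x n)) (cong (_+ length v) (length-run x n))

run-++ : ∀ x a b → run x (a + b) ≡ run x a ++ run (x + a) b
run-++ x zero    b rewrite +-identityʳ x = refl
run-++ x (suc a) b rewrite +-suc x a     = cong (x ∷_) (run-++ (suc x) a b)

drop-run : ∀ x a r v → drop a (run x (a + r) ++ v) ≡ run (x + a) r ++ v
drop-run x zero    r v rewrite +-identityʳ x = refl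
drop-run x (suc a) r v rewrite +-suc x a     = drop-run (suc x) a r v

take-run : ∀ x a r v → take a (run x (a + r) ++ v) ≡ run x a
take-run x zero    r v = refl
take-run x (suc a) r v = cong (x ∷_) (take-run (suc x) a r v)

run-< : ∀ x n {m} → x + n ≤ m → All (_< m) (run x n)
run-< x zero    p = []
run-< x (suc n) p = ≤-trans (s≤s (m≤m+n x n)) p′ ∷ run-< (suc x) n p′
  where p′ = ≤-trans (≤-reflexive (sym (+-suc x n))) p

run-injective : ∀ x m y n → run x (suc m) ≡ run y n → x ≡ y × suc m ≡ n
run-injective x m y zero    ()
run-injective x m y (suc n) eq =
  ∷-injectiveˡ eq , trans (sym (length-run x (suc m))) (trans (cong length eq) (length-run y (suc n)))

lcp-∷ : ∀ a u v → lcp (a ∷ u) (a ∷ v) ≡ suc (lcp u v)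
lcp-∷ a u v with a ≟ a
... | yes _  = refl
... | no a≢a = ⊥-elim (a≢a refl)

lcp-++ : ∀ d v → lcp d (d ++ v) ≡ length d
lcp-++ []      v = refl
lcp-++ (a ∷ d) v = trans (lcp-∷ a d (d ++ v)) (cong suc (lcp-++ d v))

lcp-run : ∀ x n m v {δ} → δ ≤ n → δ ≤ m → δ ≤ lcp (run x n) (run x m ++ v)
lcp-run x n m v z≤n _ = z≤n
lcp-run x (suc n) (suc m) v (s≤s p) (s≤s q)
  rewrite lcp-∷ x (run (suc x) n) (run (suc x) m ++ v) = s≤s (lcp-run (suc x) n m v p q)

lcp-full : ∀ d w → lcp d w ≡ length d → ∃[ v ] w ≡ d ++ v
lcp-full []      w       eq = w , refl
lcp-full (a ∷ d) (b ∷ w) eq with a ≟ b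
lcp-full (a ∷ d) (a ∷ w) eq | yes refl =
  let v , w≡ = lcp-full d w (suc-injective eq) in v , cong (a ∷_) w≡

isPrefix-++ : ∀ d v → isPrefix d (d ++ v) ≡ true
isPrefix-++ d v rewrite lcp-++ d v = n≡ᵇn (length d)
  where
  n≡ᵇn : ∀ n → (n ≡ᵇ n) ≡ true
  n≡ᵇn zero    = refl
  n≡ᵇn (suc n) = n≡ᵇn n

isPrefix⇒++ : ∀ d w → isPrefix d w ≡ true → ∃[ v ] w ≡ d ++ v
isPrefix⇒++ d w eq = lcp-full d w (≡ᵇ⇒≡ (lcp d w) (length d) (subst Data.Bool.T (sym eq) _))

longestMarked-≤ : ∀ T w {m} → (∀ {d} → d ∈ T → isPrefix d w ≡ true → length d ≤ m) → longestMarked T w ≤ m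
longestMarked-≤ []      w p = z≤n
longestMarked-≤ (d ∷ T) w p with isPrefix d w in eq
... | true  = ⊔-lub (p (here refl) eq) (longestMarked-≤ T w (λ i → p (there i)))
... | false = longestMarked-≤ T w (λ i → p (there i))

≤-longestMarked : ∀ T w {d} → d ∈ T → isPrefix d w ≡ true → length d ≤ longestMarked T w
≤-longestMarked (d ∷ T) w (here refl) eq rewrite eq = m≤m⊔n (length d) _
≤-longestMarked (d ∷ T) w (there i)   eq = ≤-trans (≤-longestMarked T w i eq) (m≤n⊔m _ _)

≤-matchDepth : ∀ T w {d} → d ∈ T → lcp d w ≤ matchDepth T w
≤-matchDepth (d ∷ T) w (here refl) = m≤m⊔n _ _
≤-matchDepth (d ∷ T) w (there i)   = ≤-trans (≤-matchDepth T w i) (m≤n⊔m _ _)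

matchDepth-fresh : ∀ T σ w → (∀ {d} → d ∈ T → All (_< σ) d) → matchDepth T (σ ∷ w) ≡ 0
matchDepth-fresh []      σ w p = refl
matchDepth-fresh (d ∷ T) σ w p = cong₂ _⊔_ (go d (p (here refl))) (matchDepth-fresh T σ w (λ i → p (there i)))
  where
  go : ∀ d → All (_< σ) d → lcp d (σ ∷ w) ≡ 0
  go []      _         = refl
  go (a ∷ d) (a<σ ∷ _) with a ≟ σ
  ... | yes refl = ⊥-elim (<-irrefl refl a<σ)
  ... | no _     = refl

search-fresh : ∀ T σ w → (∀ {d} → d ∈ T → All (_< σ) d) → search T (σ ∷ w) ≡ mkRes 1 ((σ ∷ []) ∷ T) 2
search-fresh T σ w p rewrite matchDepth-fresh T σ w p = refl

-- A string without letters from `σ` on cannot reach past the separator, so a stored string that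
-- matches there is itself a run.
prefix-run : ∀ d x r {σ v v′} → All (_< σ) d → run x r ++ σ ∷ v ≡ d ++ v′ → d ≡ run x (length d) × length d ≤ r
prefix-run []      x r       _         eq   = refl , z≤n
prefix-run (a ∷ d) x zero    (a<σ ∷ _) refl = ⊥-elim (<-irrefl refl a<σ)
prefix-run (a ∷ d) x (suc r) (_ ∷ p)   eq   with prefix-run d (suc x) r p (∷-injectiveʳ eq) | ∷-injectiveˡ eq
... | d≡ , l≤ | refl = cong (a ∷_) d≡ , s≤s l≤

-- Trie contents described by intervals.

-- (x , n) stands for the factor run x n of u$.
Intervals : Set
Intervals = List (ℕ × ℕ)

-- A search advances by at least one letter, marked or not, so pieces of length 1 need no entry in
-- `L`.
Known : Intervals → ℕ → ℕ → Set
Known L x a = a ≡ 1 ⊎ (x , a) ∈ L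

-- `p` is a lower bound for the input length, met by padding at the very end; it makes the inputs
-- arbitrarily long.
module Simulation (M p : ℕ) where

  -- M bounds the letters of u$ and separators are at least M; letters from σ on have not occurred yet.
  -- H bounds the factors (of length at least 2) in the trie from above, L from below.
  record Models (T : List Word) (H L : Intervals) (σ : ℕ) : Set where
    field
      M≤σ   : M ≤ σ
      below : ∀ {d} → d ∈ T → All (_< σ) d
      upper : ∀ {x n} → run x n ∈ T → 2 ≤ n → x + n ≤ M → (x , n) ∈ H
      lower : ∀ {x n} → (x , n) ∈ L → run x n ∈ T
  open Models

  models-mono : ∀ {T H H′ L L′ σ σ′} → (∀ {i} → i ∈ H → i ∈ H′) → (∀ {i} → i ∈ L′ → i ∈ L) → σ ≤ σ′ →
                Models T H L σ → Models T H′ L′ σ′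
  models-mono h l s m = record
    { M≤σ   = ≤-trans (M≤σ m) s
    ; below = λ i → All.map (λ p → ≤-trans p s) (below m i)
    ; upper = λ i p q → h (upper m i p q)
    ; lower = λ i → lower m (l i)
    }

  -- Serves for single letters and for strings that contain a separator: neither is a factor of u$
  -- of length at least 2.
  models-junk : ∀ {T H L σ} d → All (_< σ) d → (∀ {x n} → run x n ≡ d → 2 ≤ n → x + n ≤ M → ⊥) →
                Models T H L σ → Models (d ∷ T) H L σ
  models-junk d p q m = record
    { M≤σ   = M≤σ m
    ; below = λ { (here refl) → p ; (there i) → below m i }
    ; upper = λ { (here eq) a b → ⊥-elim (q eq a b) ; (there i) a b → upper m i a b }
    ; lower = λ i → there (lower m i)
    }

  models-letter : ∀ {T H L σ} a → a < σ → Models T H L σ → Models ((a ∷ []) ∷ T) H L σ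
  models-letter a a<σ = models-junk (a ∷ []) (a<σ ∷ []) λ { {n = suc (suc n)} () (s≤s (s≤s _)) _ }

  models-add : ∀ {T H L σ} x n → x + n ≤ M → Models T H L σ →
               Models (run x n ∷ T) ((x , n) ∷ H) ((x , n) ∷ L) σ
  models-add {T} {H} x n p m = record
    { M≤σ   = M≤σ m
    ; below = λ { (here refl) → run-< x n (≤-trans p (M≤σ m)) ; (there i) → below m i }
    ; upper = up
    ; lower = λ { (here refl) → here refl ; (there i) → there (lower m i) }
    }
    where
    up : ∀ {y k} → run y k ∈ run x n ∷ T → 2 ≤ k → y + k ≤ M → (y , k) ∈ (x , n) ∷ H
    up {y} {suc k} (here eq) a b with run-injective y k x n eq
    ... | refl , refl = here refl
    up (there i) a b = there (upper m i a b)

  -- `a` is the length of the piece found, `r` the number of letters between it and the separator.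
  -- By `deep`, the cost is at least the overlap with any run of `L` starting at `x`, however short
  -- the piece.
  record Spec (H L : Intervals) (σ x a r : ℕ) (res : SearchResult) : Set where
    field
      len≡  : len res ≡ a
      trie⊨ : Models (trie res) H L σ
      deep  : ∀ {n δ} → (x , n) ∈ L → δ ≤ n → δ ≤ a + r → δ ≤ cost res
  open Spec

  -- A marked prefix of length at least 2 is a run that stops before the separator, hence lies in
  -- `H`, where `max` limits it to `a`; conversely `kn` supplies a match of length `a`.
  search-run : ∀ {T H L σ} x a r w → Models T H L σ → 0 < a → x + (a + r) ≤ M →
               (∀ {n} → (x , n) ∈ H → n ≤ a + r → n ≤ a) → Known L x a →
               Spec H L σ x a r (search T (run x (a + r) ++ σ ∷ w))
  search-run {T} {H} {L} {σ} x (suc a) r w m 0<a p max kn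
    with matchDepth T (run x (suc a + r) ++ σ ∷ w) in eq
  ... | zero = record
    { len≡  = letter kn
    ; trie⊨ = models-letter x (≤-trans (≤-trans (s≤s (m≤m+n x (a + r))) (≤-reflexive (sym (+-suc x (a + r))))) (≤-trans p (M≤σ m))) m
    ; deep  = λ i q q′ → ≤-trans (≤-trans (lcp-run x _ (suc a + r) (σ ∷ w) q q′) (≤-matchDepth T _ (lower m i))) (≤-trans (≤-reflexive eq) z≤n)
    }
    where
    letter : Known L x (suc a) → 1 ≡ suc a
    letter (inj₁ e) = sym e
    -- A stored run from `x` would match at least its first letter, against depth 0.
    letter (inj₂ i) with ≤-trans (lcp-run x (suc a) (suc a + r) (σ ∷ w) {1} (s≤s z≤n) (s≤s z≤n)) (≤-trans (≤-matchDepth T _ (lower m i)) (≤-reflexive eq))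
    ... | ()
  ... | suc dp = record
    { len≡  = ≤-antisym (⊔-lub (s≤s z≤n) (longestMarked-≤ T _ short)) (long kn)
    ; trie⊨ = m
    ; deep  = λ i q q′ → ≤-trans (≤-trans (lcp-run x _ (suc a + r) (σ ∷ w) q q′) (≤-matchDepth T _ (lower m i))) (≤-trans (≤-reflexive eq) (n≤1+n _))
    }
    where
    short : ∀ {d} → d ∈ T → isPrefix d (run x (suc a + r) ++ σ ∷ w) ≡ true → length d ≤ suc a
    short {d} i e with isPrefix⇒++ d _ e
    ... | v , w≡ with prefix-run d x (suc a + r) (below m i) w≡
    ...   | d≡ , l≤ with 2 ≤? length d
    ...     | yes 2≤l = max (upper m (subst (_∈ T) d≡ i) 2≤l (≤-trans (+-monoʳ-≤ x l≤) p)) l≤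
    ...     | no  2≰l = ≤-trans (≤-pred (≰⇒> 2≰l)) (s≤s z≤n)
    long : Known L x (suc a) → suc a ≤ 1 ⊔ longestMarked T (run x (suc a + r) ++ σ ∷ w)
    long (inj₁ refl) = m≤m⊔n 1 (longestMarked T (run x (1 + r) ++ σ ∷ w))
    long (inj₂ i) = ≤-trans (≤-trans (≤-reflexive (sym (length-run x (suc a))))
      (≤-longestMarked T _ (lower m i)
        (subst (λ u → isPrefix (run x (suc a)) u ≡ true)
          (trans (sym (++-assoc (run x (suc a)) (run (x + suc a) r) (σ ∷ w))) (cong (_++ σ ∷ w) (sym (run-++ x (suc a) r))))
          (isPrefix-++ (run x (suc a)) _))))
      (m≤n⊔m 1 (longestMarked T (run x (suc a + r) ++ σ ∷ w)))

  -- The preceding LZMW phrase, and cost bounds for both parsings.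

  -- The previous LZMW phrase: a separator (or none), or the factor run c b.
  data Prev : Set where
    clean : Prev
    after : ℕ → ℕ → Prev

  IsPrev : ℕ → Prev → Maybe Word → Set
  IsPrev σ clean       q = q ≡ nothing ⊎ (∃[ z ] (q ≡ just (z ∷ []) × M ≤ z × z < σ))
  IsPrev σ (after c b) q = q ≡ just (run c b) × c + b ≤ M

  EndsAt : Prev → ℕ → Set
  EndsAt clean       x = ⊤
  EndsAt (after c b) x = c + b ≡ x

  -- The interval that LZMW stores on reading a piece of length `a`; after a separator the
  -- concatenation is no factor of u$.
  joined : Prev → ℕ → Intervals
  joined clean       a = []
  joined (after c b) a = (c , b + a) ∷ []

  models-insertPair : ∀ {T H L σ q} pv x a → Models T H L σ → IsPrev σ pv q → EndsAt pv x → x + a ≤ M →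
                      Models (insertPair q (run x a) T) (joined pv a ++ H) (joined pv a ++ L) σ
  models-insertPair clean x a m (inj₁ refl) _ p = m
  models-insertPair clean x a m (inj₂ (z , refl , M≤z , z<σ)) _ p =
    models-junk (z ∷ run x a) (z<σ ∷ run-< x a (≤-trans p (M≤σ m))) notRun m
    where
    notRun : ∀ {y n} → run y n ≡ z ∷ run x a → 2 ≤ n → y + n ≤ M → ⊥
    notRun {y} {suc n} eq _ y+n≤M with run-< y (suc n) y+n≤M
    ... | y<M ∷ _ = <⇒≱ (subst (_< M) (∷-injectiveˡ eq) y<M) M≤z
  models-insertPair {T} {H} {L} {σ} (after c b) x a m (refl , _) refl p =
    subst (λ d → Models (d ∷ T) ((c , b + a) ∷ H) ((c , b + a) ∷ L) σ) (run-++ c b a)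
      (models-add c (b + a) (≤-trans (≤-reflexive (sym (+-assoc c b a))) p) m)

  models-insertFresh : ∀ {T H L τ σ q} pv → Models T H L σ → IsPrev τ pv q → M ≤ τ → τ < σ →
                       Models (insertPair q (τ ∷ []) T) H L σ
  models-insertFresh {q = nothing} pv m _ _ _ = m
  models-insertFresh {τ = τ} {σ} {q = just d} pv m ip M≤τ τ<σ =
    models-junk (d ++ τ ∷ []) (All.++⁺ (prev-< pv ip) (τ<σ ∷ [])) notRun m
    where
    prev-< : ∀ pv → IsPrev τ pv (just d) → All (_< σ) d
    prev-< clean       (inj₂ (z , refl , _ , z<τ)) = <-trans z<τ τ<σ ∷ []
    prev-< (after c b) (refl , p)                  = run-< c b (≤-trans p (M≤σ m))
    notRun : ∀ {x n} → run x n ≡ d ++ τ ∷ [] → 2 ≤ n → x + n ≤ M → ⊥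
    notRun {x} {n} eq _ p with All.++⁻ʳ d (subst (All (_< M)) eq (run-< x n p))
    ... | τ<M ∷ [] = <⇒≱ τ<M M≤τ

  -- Both bounds concern the same input and the same `H` and `L`, so that one schedule serves both
  -- algorithms.
  record Costs (H L : Intervals) (σ : ℕ) (pv : Prev) (w : Word) (B : ℕ) : Set where
    field
      lzd  : ∀ f T → length w ≤ f → Models T H L σ → B ≤ lzdRun f T w
      lzmw : ∀ f T q → length w ≤ f → Models T H L σ → IsPrev σ pv q → B ≤ lzmwRun f T q w
  open Costs

  -- Only the first search of a phrase is charged. This suffices: a block of a copy of u makes two
  -- LZD phrases, so the search at its start is a first one.
  lzd-step : ∀ f T a w l₁ l₂ {v p w′} → len (search T (a ∷ w)) ≡ l₁ → drop l₁ (a ∷ w) ≡ v →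
             len (search (trie (search T (a ∷ w))) v) ≡ l₂ →
             take (l₁ + l₂) (a ∷ w) ≡ p → drop (l₁ + l₂) (a ∷ w) ≡ w′ →
             cost (search T (a ∷ w)) + lzdRun f (p ∷ trie (search (trie (search T (a ∷ w))) v)) w′ ≤ lzdRun (suc f) T (a ∷ w)
  lzd-step f T a w _ _ refl refl refl refl refl =
    +-monoˡ-≤ _ (≤-trans (m≤m+n c₁ _) (m≤m+n (c₁ + c₂) _))
    where
    c₁ = cost (search T (a ∷ w))
    c₂ = cost (search (trie (search T (a ∷ w))) (drop (len (search T (a ∷ w))) (a ∷ w)))

  lzmw-step : ∀ f T q a w l {p w′} → len (search T (a ∷ w)) ≡ l →
              take l (a ∷ w) ≡ p → drop l (a ∷ w) ≡ w′ →
              cost (search T (a ∷ w)) + lzmwRun f (insertPair q p (trie (search T (a ∷ w)))) (just p) w′ ≤ lzmwRun (suc f) T q (a ∷ w)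
  lzmw-step f T q a w _ refl refl refl = +-monoˡ-≤ _ (m≤m+n (cost (search T (a ∷ w))) _)

  Depth : Intervals → ℕ → ℕ → ℕ → Set
  Depth L x r δ = δ ≡ 0 ⊎ (∃[ n ] ((x , n) ∈ L × δ ≤ n × δ ≤ r))

  shrink : ∀ x a y r v f → 0 < a → length (run x (a + r) ++ v) ≤ suc f → length (run y r ++ v) ≤ f
  shrink x (suc a) y r v f _ p = ≤-trans (≤-reflexive (length-run-++ y r v))
    (≤-trans (+-monoˡ-≤ (length v) (m≤n+m r a)) (≤-trans (≤-reflexive (sym (length-run-++ (suc x) (a + r) v))) (≤-pred p)))

  depth≤cost : ∀ {H L σ x a r res δ} → Spec H L σ x a r res → Depth L x (a + r) δ → δ ≤ cost res
  depth≤cost sp (inj₁ refl)             = z≤n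
  depth≤cost sp (inj₂ (n , i , p , q)) = deep sp i p q

  lzmw-run : ∀ {H L σ} pv x a r w {δ B} → 0 < a → x + (a + r) ≤ M → EndsAt pv x →
             (∀ {n} → (x , n) ∈ H → n ≤ a + r → n ≤ a) → Known L x a → Depth L x (a + r) δ →
             (∀ f T → length (run (x + a) r ++ σ ∷ w) ≤ f → Models T (joined pv a ++ H) (joined pv a ++ L) σ →
                B ≤ lzmwRun f T (just (run x a)) (run (x + a) r ++ σ ∷ w)) →
             ∀ f T q → length (run x (a + r) ++ σ ∷ w) ≤ f → Models T H L σ → IsPrev σ pv q →
             δ + B ≤ lzmwRun f T q (run x (a + r) ++ σ ∷ w)
  lzmw-run {H} {L} {σ} pv x (suc a) r w 0<a p e max kn dp K (suc f) T q fuel m ip =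
    ≤-trans (+-mono-≤ (depth≤cost sp dp)
              (K f _ (shrink x (suc a) (x + suc a) r (σ ∷ w) f 0<a fuel)
                 (models-insertPair pv x (suc a) (trie⊨ sp) ip e (≤-trans (+-monoʳ-≤ x (m≤m+n (suc a) r)) p))))
      (lzmw-step f T q x _ (suc a) (len≡ sp) (take-run x (suc a) r (σ ∷ w)) (drop-run x (suc a) r (σ ∷ w)))
    where sp = search-run x (suc a) r w m 0<a p max kn

  lzd-run : ∀ {H L σ} x a b r w {δ B} → 0 < a → 0 < b → x + (a + (b + r)) ≤ M →
            (∀ {n} → (x , n) ∈ H → n ≤ a + (b + r) → n ≤ a) → Known L x a → Depth L x (a + (b + r)) δ →
            (∀ {n} → (x + a , n) ∈ H → n ≤ b + r → n ≤ b) → Known L (x + a) b →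
            (∀ f T → length (run (x + a + b) r ++ σ ∷ w) ≤ f → Models T ((x , a + b) ∷ H) ((x , a + b) ∷ L) σ →
               B ≤ lzdRun f T (run (x + a + b) r ++ σ ∷ w)) →
            ∀ f T → length (run x (a + (b + r)) ++ σ ∷ w) ≤ f → Models T H L σ →
            δ + B ≤ lzdRun f T (run x (a + (b + r)) ++ σ ∷ w)
  lzd-run {H} {L} {σ} x (suc a) b r w 0<a 0<b p max kn dp max′ kn′ K (suc f) T fuel m =
    ≤-trans (+-mono-≤ (depth≤cost sp dp)
              (K f _ (shrink x (suc a + b) (x + suc a + b) r (σ ∷ w) f (s≤s z≤n) (subst (λ u → length u ≤ suc f) word≡ fuel))
                 (models-add x (suc a + b) (≤-trans (+-monoʳ-≤ x (+-monoʳ-≤ (suc a) (m≤m+n b r))) p) (trie⊨ sp′))))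
      (lzd-step f T x _ (suc a) b (len≡ sp) (drop-run x (suc a) (b + r) (σ ∷ w)) (len≡ sp′)
        (trans (cong (take (suc a + b)) word≡) (take-run x (suc a + b) r (σ ∷ w)))
        (trans (cong (drop (suc a + b)) word≡)
          (trans (drop-run x (suc a + b) r (σ ∷ w)) (cong (λ y → run y r ++ σ ∷ w) (sym (+-assoc x (suc a) b))))))
    where
    sp  = search-run x (suc a) (b + r) w m 0<a p max kn
    sp′ = search-run (x + suc a) b r w (trie⊨ sp) 0<b (≤-trans (≤-reflexive (+-assoc x (suc a) (b + r))) p) max′ kn′
    word≡ : run x (suc a + (b + r)) ++ σ ∷ w ≡ run x (suc a + b + r) ++ σ ∷ w
    word≡ = cong (λ n → run x n ++ σ ∷ w) (sym (+-assoc (suc a) b r))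

  -- Two consecutive pieces of lengths a and b: one LZD phrase, two LZMW phrases.
  walk : ∀ {H L σ} pv x a b r w {y z δ B} → y ≡ x + a → z ≡ y + b →
         0 < a → 0 < b → x + (a + (b + r)) ≤ M → EndsAt pv x →
         (∀ {n} → (x , n) ∈ H → n ≤ a + (b + r) → n ≤ a) → Known L x a → Depth L x (a + (b + r)) δ →
         (∀ {n} → (y , n) ∈ joined pv a ++ H → n ≤ b + r → n ≤ b) → Known L y b →
         Costs ((x , a + b) ∷ joined pv a ++ H) ((x , a + b) ∷ L) σ (after y b) (run z r ++ σ ∷ w) B →
         Costs H L σ pv (run x (a + (b + r)) ++ σ ∷ w) (δ + B)
  walk {L = L} pv x a b r w refl refl 0<a 0<b p e max kn dp max′ kn′ K = record
    { lzd  = lzd-run x a b r w 0<a 0<b p max kn dp (λ i → max′ (∈-++⁺ʳ (joined pv a) i)) kn′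
               (λ f T fuel m → lzd K f T fuel (models-mono widen (λ i → i) ≤-refl m))
    -- LZMW also stores `joined pv a`. It counts in `H` but is dropped from `L`, since LZD does not
    -- store it.
    ; lzmw = lzmw-run pv x a (b + r) w 0<a p e max kn dp
               (λ f T fuel m → lzmw-run (after x a) (x + a) b r w 0<b p′ refl max′ kn′ (inj₁ refl)
                 (λ f′ T′ fuel′ m′ → lzmw K f′ T′ _ fuel′ m′ (refl , p″))
                 f T _ fuel (models-mono (λ i → i) (∈-++⁺ʳ (joined pv a)) ≤-refl m) (refl , ≤-trans (m≤m+n (x + a) _) p′))
    }
    where
    p′ = ≤-trans (≤-reflexive (+-assoc x a (b + r))) p
    p″ = ≤-trans (+-monoʳ-≤ (x + a) (m≤m+n b r)) p′
    widen : ∀ {i H} → i ∈ (x , a + b) ∷ H → i ∈ (x , a + b) ∷ joined pv a ++ H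
    widen (here e)  = here e
    widen (there i) = there (∈-++⁺ʳ (joined pv a) i)

  -- Two fresh letters are one LZD phrase and two LZMW phrases, so LZD stays aligned with the pairs
  -- of pieces. Every pair stored here contains a separator, and so will the next pair of LZMW;
  -- hence `clean`.
  finish : ∀ {H L σ} pv w {B} → Costs H L (2 + σ) clean w B → Costs H L σ pv (σ ∷ suc σ ∷ w) B
  finish {H} {L} {σ} pv w {B} K = record { lzd = d ; lzmw = m }
    where
    d : ∀ f T → 2 + length w ≤ f → Models T H L σ → B ≤ lzdRun f T (σ ∷ suc σ ∷ w)
    d (suc f) T (s≤s fuel) mo = ≤-trans (lzd K f _ (≤-trans (n≤1+n _) fuel) mo₃)
      (≤-trans (m≤n+m _ _) (lzd-step f T σ (suc σ ∷ w) 1 1 (cong len s₁) refl (cong len s₂) refl refl))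
      where
      s₁ = search-fresh T σ (suc σ ∷ w) (below mo)
      mo₁ : Models (trie (search T (σ ∷ suc σ ∷ w))) H L (suc σ)
      mo₁ = subst (λ r → Models (trie r) H L (suc σ)) (sym s₁) (models-letter σ ≤-refl (models-mono (λ i → i) (λ i → i) (n≤1+n σ) mo))
      s₂ = search-fresh _ (suc σ) w (below mo₁)
      mo₂ : Models (trie (search (trie (search T (σ ∷ suc σ ∷ w))) (suc σ ∷ w))) H L (2 + σ)
      mo₂ = subst (λ r → Models (trie r) H L (2 + σ)) (sym s₂) (models-letter (suc σ) ≤-refl (models-mono (λ i → i) (λ i → i) (n≤1+n (suc σ)) mo₁))
      notRun : ∀ {x n} → run x n ≡ σ ∷ suc σ ∷ [] → 2 ≤ n → x + n ≤ M → ⊥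
      notRun {x} {suc n} eq _ p with run-< x (suc n) p
      ... | x<M ∷ _ = <⇒≱ (subst (_< M) (∷-injectiveˡ eq) x<M) (M≤σ mo)
      mo₃ = models-junk (σ ∷ suc σ ∷ []) (n≤1+n _ ∷ ≤-refl ∷ []) notRun mo₂
    m : ∀ f T q → 2 + length w ≤ f → Models T H L σ → IsPrev σ pv q → B ≤ lzmwRun f T q (σ ∷ suc σ ∷ w)
    m (suc (suc f)) T q (s≤s (s≤s fuel)) mo ip = ≤-trans (lzmw K f _ _ fuel mo₂ (inj₂ (suc σ , refl , ≤-trans (M≤σ mo) (n≤1+n σ) , ≤-refl)))
      (≤-trans (≤-trans (m≤n+m _ (cost (search T₁ (suc σ ∷ w)))) (lzmw-step f T₁ (just (σ ∷ [])) (suc σ) w 1 (cong len s₂) refl refl))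
        (≤-trans (m≤n+m _ (cost (search T (σ ∷ suc σ ∷ w)))) (lzmw-step (suc f) T q σ (suc σ ∷ w) 1 (cong len s₁) refl refl)))
      where
      s₁ = search-fresh T σ (suc σ ∷ w) (below mo)
      T₁ = insertPair q (σ ∷ []) (trie (search T (σ ∷ suc σ ∷ w)))
      mo₁ : Models T₁ H L (suc σ)
      mo₁ = models-insertFresh pv
        (subst (λ r → Models (trie r) H L (suc σ)) (sym s₁) (models-letter σ ≤-refl (models-mono (λ i → i) (λ i → i) (n≤1+n σ) mo)))
        ip (M≤σ mo) ≤-refl
      s₂ = search-fresh T₁ (suc σ) w (below mo₁)
      mo₂ : Models (insertPair (just (σ ∷ [])) (suc σ ∷ []) (trie (search T₁ (suc σ ∷ w)))) H L (2 + σ)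
      mo₂ = models-insertFresh clean
        (subst (λ r → Models (trie r) H L (2 + σ)) (sym s₂) (models-letter (suc σ) ≤-refl (models-mono (λ i → i) (λ i → i) (n≤1+n (suc σ)) mo₁)))
        (inj₂ (σ , refl , M≤σ mo , ≤-refl)) (M≤σ mo₁) ≤-refl

  -- Inputs assembled from the end.

  -- Some input of length at most n costs at least B when it is read in state (H , L); the schedule is built
  -- backwards, so the input itself never has to be written down.
  Goal : Intervals → Intervals → ℕ → ℕ → Set
  Goal H L n B = ∀ σ → ∃[ w ] (p ≤ length w × length w ≤ n × Costs H L σ clean w B)

  Midway : Intervals → Intervals → Prev → ℕ → ℕ → ℕ → ℕ → Set
  Midway H L pv x r n B =
    ∀ σ → ∃[ w ] (p ≤ length w × length w ≤ n × Costs H L σ pv (run x r ++ σ ∷ suc σ ∷ w) B)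

  goal-mono : ∀ {H L n n′ B} → n ≤ n′ → Goal H L n B → Goal H L n′ B
  goal-mono n≤n′ G σ with G σ
  ... | w , p≤ , ≤n , K = w , p≤ , ≤-trans ≤n n≤n′ , K

  goal-end : ∀ {H L} → Goal H L p 0
  goal-end σ = replicate p 0 , ≤-reflexive (sym len-p) , ≤-reflexive len-p ,
               record { lzd = λ _ _ _ _ → z≤n ; lzmw = λ _ _ _ _ _ _ → z≤n }
    where len-p = length-replicate p

  midway-end : ∀ {H L n B} pv x → Goal H L n B → Midway H L pv x 0 n B
  midway-end pv x G σ with G (2 + σ)
  ... | w , p≤ , ≤n , K = w , p≤ , ≤n , finish pv w K

  midway-start : ∀ {H L n B} x r → Midway H L clean x r n B → Goal H L (r + (2 + n)) B
  midway-start x r G σ with G σ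
  ... | w , p≤ , ≤n , K = run x r ++ σ ∷ suc σ ∷ w ,
    ≤-trans (≤-trans p≤ (≤-trans (m≤n+m _ 2) (m≤n+m _ r))) (≤-reflexive (sym len≡r)) ,
    ≤-trans (≤-reflexive len≡r) (+-monoʳ-≤ r (s≤s (s≤s ≤n))) , K
    where len≡r = length-run-++ x r (σ ∷ suc σ ∷ w)

  midway-walk : ∀ {H L} pv x a b r {y z δ n B} → y ≡ x + a → z ≡ y + b →
         0 < a → 0 < b → x + (a + (b + r)) ≤ M → EndsAt pv x →
         (∀ {n} → (x , n) ∈ H → n ≤ a + (b + r) → n ≤ a) → Known L x a → Depth L x (a + (b + r)) δ →
         (∀ {n} → (y , n) ∈ joined pv a ++ H → n ≤ b + r → n ≤ b) → Known L y b →
         Midway ((x , a + b) ∷ joined pv a ++ H) ((x , a + b) ∷ L) (after y b) z r n B →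
         Midway H L pv x (a + (b + r)) n (δ + B)
  midway-walk pv x a b r e₁ e₂ 0<a 0<b q e max kn dp max′ kn′ G σ with G σ
  ... | w , p≤ , ≤n , K = w , p≤ , ≤n , walk pv x a b r (suc σ ∷ w) e₁ e₂ 0<a 0<b q e max kn dp max′ kn′ K

  -- Puts one interval into both dictionaries: a factor read as two pieces, then two separators. The
  -- second piece ends at the separator, so no longer match has to be excluded for it.
  fragment : ∀ {H L} x a b {y c q n B} → y ≡ x + a → a + b ≡ c → 0 < a → 0 < b → x + c ≤ M → c + 2 ≤ q →
             (∀ {n} → (x , n) ∈ H → n ≤ c → n ≤ a) → Known L x a → Known L y b →
             Goal ((x , c) ∷ H) ((x , c) ∷ L) n B → Goal H L (q + n) B
  fragment {H} {L} x a b {y} {q = q} {n} {B} e₁ refl 0<a 0<b p≤ q≥ max kn kn′ G =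
    goal-mono (≤-trans (≤-reflexive (trans (cong (_+ (2 + n)) r≡) (sym (+-assoc (a + b) 2 n)))) (+-monoˡ-≤ n q≥))
      (midway-start x (a + (b + 0))
        (midway-walk clean x a b 0 e₁ refl 0<a 0<b (subst (λ r → x + r ≤ M) (sym r≡) p≤) _
          (λ i l → max i (≤-trans l (≤-reflexive r≡))) kn (inj₁ refl) (λ _ l → ≤-trans l (≤-reflexive (+-identityʳ b))) kn′
          (midway-end (after y b) (y + b) G)))
    where
    r≡ : a + (b + 0) ≡ a + b
    r≡ = cong (a +_) (+-identityʳ b)

-- Blocks and their invariants.

module Schedule (k : ℕ) where

  -- The letter `k * ℓ` is $, so a factor with `x + n ≡ M` ends with $.
  ℓ M : ℕ
  ℓ = 3 + 3 * k
  M = suc (k * ℓ)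

  open Simulation M k

  -- The stages r ≥ t of the block at x are still possible: nothing starts at x + 3r or x + 3r + 1,
  -- and the longest factor starting at x + 3r + 2 within the block reaches its end x + 3r + 2 + (1 + 3i).
  record Tail (t x : ℕ) (H L : Intervals) : Set where
    field
      free₀ : ∀ {r n} → t ≤ r → r ≤ k → ¬ (x + 3 * r , n) ∈ H
      free₁ : ∀ {r n} → t ≤ r → r ≤ k → ¬ (x + (1 + 3 * r) , n) ∈ H
      right : ∀ {r i n} → r + i ≡ k → t ≤ r → (x + (2 + 3 * r) , n) ∈ H → n ≤ 1 + 3 * i
      known : ∀ {r i} → r + i ≡ k → t ≤ r → Known L (x + (2 + 3 * r)) (1 + 3 * i)
  open Tail

  -- The longest factor at x is the one of length s, apart from u[x..]$.
  record Block (s t x : ℕ) (H L : Intervals) : Set where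
    field
      top      : ∀ {n} → (x , n) ∈ H → n ≤ s ⊎ M ≤ x + n
      topKnown : Known L x s
      long     : ∃[ D ] ((x , D) ∈ L × M ≤ x + D)
      tail     : Tail t x H L
  open Block

  known-mono : ∀ {L x a} A → Known L x a → Known (A ++ L) x a
  known-mono A (inj₁ e) = inj₁ e
  known-mono A (inj₂ i) = inj₂ (∈-++⁺ʳ A i)

  tail-narrow : ∀ {t t′ x H L} → t ≤ t′ → Tail t x H L → Tail t′ x H L
  tail-narrow t≤ T = record
    { free₀ = λ a → free₀ T (≤-trans t≤ a)
    ; free₁ = λ a → free₁ T (≤-trans t≤ a)
    ; right = λ e a → right T e (≤-trans t≤ a)
    ; known = λ e a → known T e (≤-trans t≤ a)
    }

  -- New factors starting at such `a` do not disturb the stages from `t` on in the block at `x`: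
  -- they start left of the positions used there, or beyond the block.
  Away : ℕ → ℕ → ℕ → Set
  Away t x a = a < x + 3 * t ⊎ x + ℓ ≤ a

  Off : ℕ → ℕ → ℕ → Set
  Off t x a = a ≢ x × Away t x a

  tail-frame : ∀ {t x H L} A A′ → All (λ i → Away t x (proj₁ i)) A → Tail t x H L → Tail t x (A ++ H) (A′ ++ L)
  tail-frame {t} {x} {H} A A′ off T = record
    { free₀ = λ {r} t≤r r≤k i → free₀ T t≤r r≤k (old 0 t≤r r≤k z≤n i)
    ; free₁ = λ {r} t≤r r≤k i → free₁ T t≤r r≤k (old 1 t≤r r≤k (s≤s z≤n) i)
    ; right = λ {r} e t≤r i → right T e t≤r (old 2 t≤r (≤-trans (m≤m+n r _) (≤-reflexive e)) ≤-refl i)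
    ; known = λ e t≤r → known-mono A′ (known T e t≤r)
    }
    where
    old : ∀ {r n} j → t ≤ r → r ≤ k → j ≤ 2 → (x + (j + 3 * r) , n) ∈ A ++ H → (x + (j + 3 * r) , n) ∈ H
    old {r} j t≤r r≤k j≤2 i with ∈-++⁻ A i
    ... | inj₂ i′ = i′
    ... | inj₁ i′ with All.lookup off i′
    ...   | inj₁ a< = ⊥-elim (<⇒≱ a< (+-monoʳ-≤ x (≤-trans (*-monoʳ-≤ 3 t≤r) (m≤n+m (3 * r) j))))
    ...   | inj₂ ≤a = ⊥-elim (<⇒≱ (+-monoʳ-< x (+-mono-≤ (s≤s j≤2) (*-monoʳ-≤ 3 r≤k))) ≤a)

  tail-extend : ∀ {r x H L} → Tail (suc r) x H L → (∀ {a n} → (a , n) ∈ H → x + (2 + 3 * r) ≤ a) →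
                (∀ {i n} → r + i ≡ k → (x + (2 + 3 * r) , n) ∈ H → n ≤ 1 + 3 * i) →
                (∀ {i} → r + i ≡ k → Known L (x + (2 + 3 * r)) (1 + 3 * i)) → Tail r x H L
  tail-extend {r} {x} {H} {L} T starts bound kn = record
    { free₀ = f₀ ; free₁ = f₁ ; right = rt ; known = kw }
    where
    f₀ : ∀ {q n} → r ≤ q → q ≤ k → ¬ (x + 3 * q , n) ∈ H
    f₀ r≤q q≤k i with m≤n⇒m<n∨m≡n r≤q
    ... | inj₁ r<q  = free₀ T r<q q≤k i
    ... | inj₂ refl = <⇒≱ (+-monoʳ-< x (n≤1+n _)) (starts i)
    f₁ : ∀ {q n} → r ≤ q → q ≤ k → ¬ (x + (1 + 3 * q) , n) ∈ H
    f₁ r≤q q≤k i with m≤n⇒m<n∨m≡n r≤q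
    ... | inj₁ r<q  = free₁ T r<q q≤k i
    ... | inj₂ refl = <⇒≱ (+-monoʳ-< x ≤-refl) (starts i)
    rt : ∀ {q i n} → q + i ≡ k → r ≤ q → (x + (2 + 3 * q) , n) ∈ H → n ≤ 1 + 3 * i
    rt e r≤q i with m≤n⇒m<n∨m≡n r≤q
    ... | inj₁ r<q  = right T e r<q i
    ... | inj₂ refl = bound e i
    kw : ∀ {q i} → q + i ≡ k → r ≤ q → Known L (x + (2 + 3 * q)) (1 + 3 * i)
    kw e r≤q with m≤n⇒m<n∨m≡n r≤q
    ... | inj₁ r<q  = known T e r<q
    ... | inj₂ refl = kn e

  block-frame : ∀ {s t x H L} A A′ → All (λ i → Off t x (proj₁ i)) A → Block s t x H L → Block s t x (A ++ H) (A′ ++ L)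
  block-frame {s} {t} {x} {H} A A′ off b = record
    { top      = λ i → top b (old i)
    ; topKnown = known-mono A′ (topKnown b)
    ; long     = let D , i , q = long b in D , ∈-++⁺ʳ A′ i , q
    ; tail     = tail-frame A A′ (All.map proj₂ off) (tail b)
    }
    where
    old : ∀ {n} → (x , n) ∈ A ++ H → (x , n) ∈ H
    old i with ∈-++⁻ A i
    ... | inj₂ i′ = i′
    ... | inj₁ i′ = ⊥-elim (proj₁ (All.lookup off i′) refl)

  off-left : ∀ {t x a} → a < x → Off t x a
  off-left {t} {x} a<x = <⇒≢ a<x , inj₁ (≤-trans a<x (m≤m+n x (3 * t)))

  off-right : ∀ {t x a} → x + ℓ ≤ a → Off t x a
  off-right {x = x} ≤a = (λ e → <⇒≱ (m<m+n x (s≤s z≤n)) (subst (x + ℓ ≤_) e ≤a)) , inj₂ ≤a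

  block-end : ∀ {c d} → c < d → c * ℓ + ℓ ≤ d * ℓ
  block-end {c} {d} c<d = ≤-trans (≤-reflexive (+-comm (c * ℓ) ℓ)) (*-monoˡ-≤ ℓ c<d)

  -- Setup: the blocks from right to left.

  StartsFrom : ℕ → Intervals → Set
  StartsFrom y H = ∀ {a n} → (a , n) ∈ H → y ≤ a

  starts-∷ : ∀ {y a n H} → y ≤ a → StartsFrom y H → StartsFrom y ((a , n) ∷ H)
  starts-∷ y≤a st (here refl) = y≤a
  starts-∷ y≤a st (there i)   = st i

  -- `J` is whatever must survive while the block at `x` is built; the factors added then all start
  -- left of the finished blocks.
  Stable : ℕ → (Intervals → Intervals → Set) → Set
  Stable x J = ∀ {H L a n} → a < x + ℓ → J H L → J ((a , n) ∷ H) ((a , n) ∷ L)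

  -- With y = x + 3r + 2, storing [y , y+3) first makes the greedy parse of [y , x+ℓ) jump over y+1 and y+2,
  -- so that no stored factor starts there.
  rights : ∀ {n B} J x → x + ℓ ≤ M → Stable x J →
           (∀ {H L} → J H L → StartsFrom (x + 2) H → Tail 0 x H L → Goal H L n B) →
           ∀ r i → r + i ≡ k → ∀ {H L} → J H L → StartsFrom (x + (2 + 3 * r)) H → Tail r x H L →
           Goal H L (r * (3 * (ℓ + 2)) + n) B
  rights J x x+ℓ≤M st K zero    i e jt sf T = K jt sf T
  rights {n} J x x+ℓ≤M st K (suc r) i e {H} {L} jt sf T =
    goal-mono (≤-reflexive (lens (ℓ + 2) r n))
      (fragment y 1 1 refl refl (s≤s z≤n) (s≤s z≤n) (fits 2≤c) (fitsℓ 2≤c)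
        (λ i _ → ⊥-elim (none i)) (inj₁ refl) (inj₁ refl)
      (fragment y 2 1 refl refl (s≤s z≤n) (s≤s z≤n) (fits 3≤c) (fitsℓ 3≤c)
        (λ { (here refl) _ → ≤-refl ; (there i) _ → ⊥-elim (none i) }) (inj₂ (here refl)) (inj₁ refl)
      -- The second piece was stored in the round of `suc r`, or is a letter when `i` is 0.
      (fragment y 3 (1 + 3 * i) y′≡ (c≡ i) (s≤s z≤n) (s≤s z≤n) (fits ≤-refl) (fitsℓ ≤-refl)
        (λ { (here refl) _ → ≤-refl ; (there (here refl)) _ → n≤1+n 2 ; (there (there i)) _ → ⊥-elim (none i) })
        (inj₂ (here refl)) (known-mono ((y , 3) ∷ (y , 2) ∷ []) (known T e ≤-refl))
      (rights J x x+ℓ≤M st K r (suc i) (trans (+-suc r i) e)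
        (st y< (st y< (st y< jt))) (starts-∷ ≤-refl (starts-∷ ≤-refl (starts-∷ ≤-refl sf′)))
        (tail-extend (tail-frame adds adds (inj₁ y<′ ∷ inj₁ y<′ ∷ inj₁ y<′ ∷ []) T)
          (starts-∷ ≤-refl (starts-∷ ≤-refl (starts-∷ ≤-refl sf′))) bound kn)))))
    where
    y = x + (2 + 3 * r)
    c = 1 + 3 * suc i
    adds = (y , c) ∷ (y , 3) ∷ (y , 2) ∷ []
    lens : ∀ q r n → q + (q + (q + (r * (3 * q) + n))) ≡ suc r * (3 * q) + n
    lens = solve-∀
    c≡ : ∀ i → 3 + (1 + 3 * i) ≡ 1 + 3 * suc i
    c≡ = solve-∀
    y′≡ : x + (2 + 3 * suc r) ≡ y + 3
    y′≡ = go x r where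
      go : ∀ x r → x + (2 + 3 * suc r) ≡ x + (2 + 3 * r) + 3
      go = solve-∀
    c+r : (2 + 3 * r) + c ≡ ℓ
    c+r = trans (go r i) (cong (λ q → 3 + 3 * q) e) where
      go : ∀ r i → (2 + 3 * r) + (1 + 3 * suc i) ≡ 3 + 3 * (suc r + i)
      go = solve-∀
    3≤c : 3 ≤ c
    3≤c = ≤-trans (m≤m*n 3 (suc i)) (n≤1+n _)
    2≤c : 2 ≤ c
    2≤c = ≤-trans (n≤1+n 2) 3≤c
    fits : ∀ {m} → m ≤ c → y + m ≤ M
    fits m≤c = ≤-trans (+-monoʳ-≤ y m≤c) (≤-trans (≤-reflexive (trans (+-assoc x _ c) (cong (x +_) c+r))) x+ℓ≤M)
    fitsℓ : ∀ {m} → m ≤ c → m + 2 ≤ ℓ + 2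
    fitsℓ m≤c = +-monoˡ-≤ 2 (≤-trans m≤c (≤-trans (m≤n+m c (2 + 3 * r)) (≤-reflexive c+r)))
    y<′ : y < x + 3 * suc r
    y<′ = ≤-reflexive (go x r) where
      go : ∀ x r → suc (x + (2 + 3 * r)) ≡ x + 3 * suc r
      go = solve-∀
    y< : y < x + ℓ
    y< = +-monoʳ-< x (≤-trans (m<m+n (2 + 3 * r) {c} (s≤s z≤n)) (≤-reflexive c+r))
    sf′ : StartsFrom y H
    sf′ i = ≤-trans (≤-trans (m≤m+n y 3) (≤-reflexive (sym y′≡))) (sf i)
    none : ∀ {n} → ¬ (y , n) ∈ H
    none i = <⇒≱ (m<m+n y {3} (s≤s z≤n)) (≤-trans (≤-reflexive (sym y′≡)) (sf i))
    i≡ : ∀ {i′} → r + i′ ≡ k → suc i ≡ i′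
    i≡ e′ = +-cancelˡ-≡ r _ _ (trans (trans (+-suc r i) e) (sym e′))
    bound : ∀ {i′ n} → r + i′ ≡ k → (y , n) ∈ adds ++ H → n ≤ 1 + 3 * i′
    bound e′ m with i≡ e′
    bound e′ (here refl)                 | refl = ≤-refl
    bound e′ (there (here refl))         | refl = 3≤c
    bound e′ (there (there (here refl))) | refl = 2≤c
    bound e′ (there (there (there m)))   | refl = ⊥-elim (none m)
    kn : ∀ {i′} → r + i′ ≡ k → Known (adds ++ L) y (1 + 3 * i′)
    kn e′ with i≡ e′
    ... | refl = inj₂ (here refl)

  -- At stage `k` the right piece has length 1 and so is a letter; there are no stages beyond.
  tail-k : ∀ {x H L} → StartsFrom (x + ℓ) H → Tail k x H L
  tail-k {x} {H} {L} sf = tail-extend empty (λ i → ≤-trans (+-monoʳ-≤ x (n≤1+n _)) (sf i))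
    (λ _ i → ⊥-elim (<⇒≱ (+-monoʳ-< x ≤-refl) (sf i)))
    (λ e → inj₁ (cong (λ i → 1 + 3 * i) (+-cancelˡ-≡ k _ 0 (trans e (sym (+-identityʳ k))))))
    where
    empty : Tail (suc k) x H L
    empty = record
      { free₀ = λ a b _ → <⇒≱ a b
      ; free₁ = λ a b _ → <⇒≱ a b
      ; right = λ {r} e a _ → ⊥-elim (<⇒≱ a (≤-trans (m≤m+n r _) (≤-reflexive e)))
      ; known = λ {r} e a → ⊥-elim (<⇒≱ a (≤-trans (m≤m+n r _) (≤-reflexive e)))
      }

  Blocks : ℕ → ℕ → Intervals → Intervals → Set
  Blocks s t H L = ∀ d → d < k → Block s t (d * ℓ) H L

  -- `D` is the length of the suffix of u$ from the start of block `c`, to which the block on its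
  -- left will be joined.
  record Ready (c : ℕ) (H L : Intervals) : Set where
    field
      blocks : ∀ d → c ≤ d → d < k → Block 1 1 (d * ℓ) H L
      starts : StartsFrom (c * ℓ) H
      D      : ℕ
      knownD : Known L (c * ℓ) D
      D≡     : c * ℓ + D ≡ M
  open Ready

  setupLength : ℕ
  setupLength = k * (3 * (ℓ + 2)) + ((ℓ + 2) + ((M + 2) + (M + 2)))

  -- The suffix of u$ from `x + 1` is stored first and then extended to the left by the letter `x`;
  -- so no other stored factor starts at `x`.
  setup : ∀ {n B} → (∀ {H L} → Blocks 1 1 H L → Goal H L n B) →
          ∀ c → c ≤ k → ∀ {H L} → Ready c H L → Goal H L (c * setupLength + n) B
  setup K zero    c≤k R = K (λ d d<k → blocks R d z≤n d<k)
  setup {n} {B} K (suc c) c<k {H₀} {L₀} R =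
    goal-mono (≤-reflexive (lens (k * (3 * (ℓ + 2))) (ℓ + 2) (M + 2) (c * setupLength + n) n refl))
      (rights J x (≤-trans (≤-trans (≤-reflexive E≡) (*-monoˡ-≤ ℓ c<k)) (n≤1+n _)) stable built k 0 (+-identityʳ k)
        ((λ d → blocks R d) , knownD R) (λ i → ≤-trans (+-monoʳ-≤ x (n≤1+n _)) (sf i)) (tail-k sf))
    where
    x = c * ℓ
    E≡ : x + ℓ ≡ suc c * ℓ
    E≡ = +-comm x ℓ
    sf : StartsFrom (x + ℓ) H₀
    sf i = ≤-trans (≤-reflexive E≡) (starts R i)
    J : Intervals → Intervals → Set
    J H L = (∀ d → suc c ≤ d → d < k → Block 1 1 (d * ℓ) H L) × Known L (suc c * ℓ) (D R)
    stable : Stable x J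
    stable {a = a} {m} a< (bl , kn) =
      (λ d c<d d<k → block-frame ((a , m) ∷ []) ((a , m) ∷ []) (off-left {1} (≤-trans a< (block-end c<d)) ∷ []) (bl d c<d d<k)) ,
      known-mono ((a , m) ∷ []) kn
    c₁ = 2 + 3 * k
    c₂ = c₁ + D R
    c₃ = 1 + c₂
    lens : ∀ a b d m n → m ≡ c * (a + (b + (d + d))) + n → a + (b + (d + (d + m))) ≡ suc c * (a + (b + (d + d))) + n
    lens a b d m n refl = go c a b d n where
      go : ∀ c a b d n → a + (b + (d + (d + (c * (a + (b + (d + d))) + n)))) ≡ suc c * (a + (b + (d + d))) + n
      go = solve-∀
    M≡ : x + c₃ ≡ M
    M≡ = trans (go x (3 * k) (D R)) (D≡ R) where
      go : ∀ x y D → x + (1 + ((2 + y) + D)) ≡ (3 + y) + x + D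
      go = solve-∀
    0<D : 0 < D R
    0<D = +-cancelˡ-≤ (suc c * ℓ) 1 (D R) (≤-trans (≤-reflexive (+-comm _ 1)) (≤-trans (s≤s (*-monoˡ-≤ ℓ c<k)) (≤-reflexive (sym (D≡ R)))))
    c₃≤M : c₃ ≤ M
    c₃≤M = ≤-trans (m≤n+m c₃ x) (≤-reflexive M≡)
    built : ∀ {H L} → J H L → StartsFrom (x + 2) H → Tail 0 x H L →
            Goal H L ((ℓ + 2) + ((M + 2) + ((M + 2) + (c * setupLength + n)))) B
    built {H} {L} jt st T =
      fragment (suc x) 1 (1 + 3 * k) (go₁ x) refl (s≤s z≤n) (s≤s z≤n)
        (≤-trans (≤-trans (+-monoʳ-≤ (suc x) (m≤m+n c₁ (D R))) (≤-reflexive (sym (+-suc x c₂)))) (≤-reflexive M≡))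
        (+-monoˡ-≤ 2 (n≤1+n c₁))
        (λ i _ → ⊥-elim (none₁ i)) (inj₁ refl) (known T {0} {k} refl z≤n)
      (fragment (suc x) c₁ (D R) (go₂ x (3 * k)) refl (s≤s z≤n) 0<D
        (≤-trans (≤-reflexive (sym (+-suc x c₂))) (≤-reflexive M≡)) (+-monoˡ-≤ 2 (≤-trans (n≤1+n c₂) c₃≤M))
        (λ { (here refl) _ → ≤-refl ; (there i) _ → ⊥-elim (none₁ i) }) (inj₂ (here refl)) (proj₂ jt₁)
      (fragment x 1 c₂ (+-comm 1 x) refl (s≤s z≤n) (s≤s z≤n) (≤-reflexive M≡) (+-monoˡ-≤ 2 c₃≤M)
        (λ { (here e) _ → ⊥-elim (1+n≢n (sym (cong proj₁ e))) ; (there (here e)) _ → ⊥-elim (1+n≢n (sym (cong proj₁ e))) ; (there (there i)) _ → ⊥-elim (none₀ i) })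
        (inj₁ refl) (inj₂ (here refl))
      (setup K c (<⇒≤ c<k) ready)))
      where
      go₁ : ∀ x → x + 2 ≡ suc x + 1
      go₁ = solve-∀
      go₂ : ∀ x y → (3 + y) + x ≡ suc x + (2 + y)
      go₂ = solve-∀
      none₁ : ∀ {n} → ¬ (suc x , n) ∈ H
      none₁ i = <⇒≱ ≤-refl (≤-trans (≤-reflexive (+-comm 2 x)) (st i))
      none₀ : ∀ {n} → ¬ (x , n) ∈ H
      none₀ i = <⇒≱ (n≤1+n _) (≤-trans (≤-reflexive (+-comm 2 x)) (st i))
      x<  : x < x + ℓ
      x< = m<m+n x (s≤s z≤n)
      sx< : suc x < x + ℓ
      sx< = ≤-trans (≤-reflexive (+-comm 2 x)) (+-monoʳ-≤ x (s≤s (s≤s z≤n)))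
      adds = (x , c₃) ∷ (suc x , c₂) ∷ (suc x , c₁) ∷ []
      jt₁ = stable sx< jt
      jt₃ : J (adds ++ H) (adds ++ L)
      jt₃ = stable x< (stable sx< jt₁)
      block : Block 1 1 x (adds ++ H) (adds ++ L)
      block = record
        { top = λ { (here refl) → inj₂ (≤-reflexive (sym M≡)) ; (there (here e)) → ⊥-elim (1+n≢n (sym (cong proj₁ e)))
                  ; (there (there (here e))) → ⊥-elim (1+n≢n (sym (cong proj₁ e))) ; (there (there (there i))) → ⊥-elim (none₀ i) }
        ; topKnown = inj₁ refl
        ; long = c₃ , here refl , ≤-reflexive (sym M≡)
        -- Stage 0 is given up, as `x` and `x + 1` now start stored factors.
        ; tail = tail-frame adds adds (inj₁ (m<m+n x (s≤s z≤n)) ∷ inj₁ sx<3 ∷ inj₁ sx<3 ∷ []) (tail-narrow z≤n T)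
        }
        where
        sx<3 : suc x < x + 3
        sx<3 = ≤-trans (n≤1+n _) (≤-reflexive (+-comm 3 x))
      ready : Ready c (adds ++ H) (adds ++ L)
      ready = record
        { blocks = bl
        ; starts = starts-∷ ≤-refl (starts-∷ (n≤1+n x) (starts-∷ (n≤1+n x) (λ i → ≤-trans (m≤m+n x 2) (st i))))
        ; D = c₃ ; knownD = inj₂ (here refl) ; D≡ = M≡ }
        where
        bl : ∀ d → c ≤ d → d < k → Block 1 1 (d * ℓ) (adds ++ H) (adds ++ L)
        bl d c≤d d<k with m≤n⇒m<n∨m≡n c≤d
        ... | inj₁ c<d  = proj₁ jt₃ d c<d d<k
        ... | inj₂ refl = block

  -- Stages: sweeps over the blocks from left to right.

  -- Midway through a sweep over the blocks from left to right.
  record Mixed (s′ t′ s t c : ℕ) (H L : Intervals) : Set where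
    field
      done : ∀ d → d < c → d < k → Block s′ t′ (d * ℓ) H L
      todo : ∀ d → c ≤ d → d < k → Block s t (d * ℓ) H L
  open Mixed

  mixed-start : ∀ {s′ t′ s t H L} → Blocks s t H L → Mixed s′ t′ s t 0 H L
  mixed-start bl = record { done = λ _ () ; todo = λ d _ → bl d }

  mixed-end : ∀ {s′ t′ s t c H L} → c ≡ k → Mixed s′ t′ s t c H L → Blocks s′ t′ H L
  mixed-end refl mx d d<k = done mx d d<k d<k

  mixed-next : ∀ {s′ t′ s t c H L} A A′ → Block s′ t′ (c * ℓ) (A ++ H) (A′ ++ L) →
               (∀ d → d < c → All (λ i → Off t′ (d * ℓ) (proj₁ i)) A) → All (λ i → proj₁ i < c * ℓ + ℓ) A →
               Mixed s′ t′ s t c H L → Mixed s′ t′ s t (suc c) (A ++ H) (A′ ++ L)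
  mixed-next {s′} {t′} {s} {t} {c} {H} {L} A A′ new offl offr mx = record
    { done = dn
    ; todo = λ d c<d d<k → block-frame A A′ (All.map (λ a< → off-left {t} (≤-trans a< (block-end c<d))) offr)
                             (todo mx d (<⇒≤ c<d) d<k)
    }
    where
    dn : ∀ d → d < suc c → d < k → Block s′ t′ (d * ℓ) (A ++ H) (A′ ++ L)
    dn d (s≤s d≤c) d<k with m≤n⇒m<n∨m≡n d≤c
    ... | inj₁ d<c  = block-frame A A′ (offl d d<c) (done mx d d<c d<k)
    ... | inj₂ refl = new

  c<k : ∀ c {j} → c + suc j ≡ k → c < k
  c<k c e = ≤-trans (m<m+n c (s≤s z≤n)) (≤-reflexive e)

  -- The fragment stays left of $, so u[x..]$ is no match; the factor of length `s` is the longest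
  -- one and gains a letter.
  preset : ∀ {n B} s t → 0 < s → 0 < t → suc s ≤ ℓ →
           (∀ {H L} → Blocks (suc s) t H L → Goal H L n B) →
           ∀ j c → c + j ≡ k → ∀ {H L} → Mixed (suc s) t s t c H L → Goal H L (j * (ℓ + 2) + n) B
  preset s t 0<s 0<t s<ℓ K zero c e mx = K (mixed-end (trans (sym (+-identityʳ c)) e) mx)
  preset {n} s t 0<s 0<t s<ℓ K (suc j) c e {H} {L} mx =
    goal-mono (≤-reflexive (sym (+-assoc (ℓ + 2) (j * (ℓ + 2)) n)))
      (fragment x s 1 refl (+-comm s 1) 0<s (s≤s z≤n) (≤-trans fits (n≤1+n _)) (+-monoˡ-≤ 2 s<ℓ)
        max (topKnown b) (inj₁ refl)
        (preset s t 0<s 0<t s<ℓ K j (suc c) (trans (sym (+-suc c j)) e)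
          (mixed-next ((x , suc s) ∷ []) ((x , suc s) ∷ []) new
            (λ d d<c → off-right {t} (block-end d<c) ∷ []) (m<m+n x (s≤s z≤n) ∷ []) mx)))
    where
    x = c * ℓ
    b = todo mx c ≤-refl (c<k c e)
    fits : x + suc s ≤ k * ℓ
    fits = ≤-trans (+-monoʳ-≤ x s<ℓ) (block-end (c<k c e))
    max : ∀ {n} → (x , n) ∈ H → n ≤ suc s → n ≤ s
    max i n≤ with top b i
    ... | inj₁ n≤s = n≤s
    ... | inj₂ M≤  = ⊥-elim (<⇒≱ (s≤s (≤-trans (+-monoʳ-≤ x n≤) fits)) M≤)
    new : Block (suc s) t x ((x , suc s) ∷ H) ((x , suc s) ∷ L)
    new = record
      { top = λ { (here refl) → inj₁ ≤-refl ; (there i) → map₁ m≤n⇒m≤1+n (top b i) }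
      ; topKnown = inj₂ (here refl)
      ; long = let D , i , q = long b in D , there i , q
      ; tail = tail-frame (_ ∷ []) (_ ∷ []) (inj₁ (m<m+n x (*-mono-< {0} {3} {0} {t} (s≤s z≤n) 0<t)) ∷ []) (tail b)
      }

  -- `tri k * ℓ` is the sum of the distances from the block starts to the end of u.
  tri : ℕ → ℕ
  tri zero    = 0
  tri (suc j) = suc j + tri j

  prevAt : ℕ → ℕ → ℕ → Prev
  prevAt t i zero    = clean
  prevAt t i (suc c) = after (c * ℓ + (2 + 3 * t)) (1 + 3 * i)

  -- Each block splits into pieces of lengths `3 * t`, 1, 1 and `1 + 3 * i`. The search at its start
  -- is charged the whole rest of the copy, with which u[x..]$ agrees.
  probe : ∀ {n B} t i → 0 < t → t + i ≡ k →
          (∀ {H L} → Blocks (1 + 3 * t) (1 + t) H L → Goal H L n B) →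
          ∀ j c → c + j ≡ k → ∀ {H L} → Mixed (1 + 3 * t) (1 + t) (3 * t) t c H L →
          Midway H L (prevAt t i c) (c * ℓ) (j * ℓ) n (tri j * ℓ + B)
  probe t i 0<t e K zero c e′ mx = midway-end _ (c * ℓ) (K (mixed-end (trans (sym (+-identityʳ c)) e′) mx))
  probe {n} {B} t i 0<t e K (suc j) c e′ {H} {L} mx =
    subst₂ (λ r B′ → Midway H L pv x r n B′) (sym r≡) (sym (+-assoc-ℓ (tri j)))
      (midway-walk pv x s 1 (1 + (d + r′)) refl z≡ 0<s (s≤s z≤n) fits (ends c)
        max (topKnown b) deep (λ m _ → ⊥-elim (none₀ m)) (inj₁ refl)
      (midway-walk (after (x + s) 1) z 1 d r′ {δ = 0} y₂≡ z₂≡ (s≤s z≤n) (s≤s z≤n) fits₂ (sym z≡)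
        (λ m _ → ⊥-elim (none₁ m)) (inj₁ refl) (inj₁ refl) (λ m _ → bound m) (known-mono ((x , s + 1) ∷ []) (known tl e ≤-refl))
      (probe t i 0<t e K j (suc c) (trans (sym (+-suc c j)) e′)
        (mixed-next A A′ new offl offr mx))))
    where
    x  = c * ℓ
    s  = 3 * t
    d  = 1 + 3 * i
    r′ = j * ℓ
    z  = x + (1 + s)
    pv = prevAt t i c
    b  = todo mx c ≤-refl (c<k c e′)
    tl = tail b
    -- `A` is what LZMW stores while reading the block, `A′` the part of it that LZD stores.
    A  = (z , 1 + d) ∷ (x + s , 1 + 1) ∷ (x , s + 1) ∷ joined pv s
    A′ = (z , 1 + d) ∷ (x , s + 1) ∷ []
    0<s : 0 < s
    0<s = *-mono-< {0} {3} {0} {t} (s≤s z≤n) 0<t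
    ℓ≡ : s + (1 + (1 + d)) ≡ ℓ
    ℓ≡ = trans (go t i) (cong (λ q → 3 + 3 * q) e) where
      go : ∀ t i → 3 * t + (1 + (1 + (1 + 3 * i))) ≡ 3 + 3 * (t + i)
      go = solve-∀
    r≡ : ℓ + r′ ≡ s + (1 + (1 + (d + r′)))
    r≡ = trans (cong (_+ r′) (sym ℓ≡)) (+-assoc s (1 + (1 + d)) r′)
    +-assoc-ℓ : ∀ q → (suc j + q) * ℓ + B ≡ (ℓ + r′) + (q * ℓ + B)
    +-assoc-ℓ q = go j q ℓ B where
      go : ∀ j q l B → (suc j + q) * l + B ≡ (l + j * l) + (q * l + B)
      go = solve-∀
    all≡ : x + (ℓ + r′) ≡ k * ℓ
    all≡ = trans (sym (*-distribʳ-+ ℓ c (suc j))) (cong (_* ℓ) e′)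
    fits : x + (s + (1 + (1 + (d + r′)))) ≤ M
    fits = ≤-trans (≤-reflexive (trans (cong (x +_) (sym r≡)) all≡)) (n≤1+n _)
    fits₂ : z + (1 + (d + r′)) ≤ M
    fits₂ = ≤-trans (≤-reflexive (go x s (d + r′))) fits where
      go : ∀ x s q → x + (1 + s) + (1 + q) ≡ x + (s + (1 + (1 + q)))
      go = solve-∀
    z≡ : z ≡ x + s + 1
    z≡ = go x s where
      go : ∀ x s → x + (1 + s) ≡ x + s + 1
      go = solve-∀
    y₂≡ : x + (2 + s) ≡ z + 1
    y₂≡ = go x s where
      go : ∀ x s → x + (2 + s) ≡ x + (1 + s) + 1
      go = solve-∀
    end≡ : ∀ x → x + (2 + s) + d ≡ ℓ + x
    end≡ x = trans (go x s d) (cong (_+ x) ℓ≡) where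
      go : ∀ x s d → x + (2 + s) + d ≡ s + (1 + (1 + d)) + x
      go = solve-∀
    z₂≡ : ℓ + x ≡ x + (2 + s) + d
    z₂≡ = sym (end≡ x)
    ends : ∀ c → EndsAt (prevAt t i c) (c * ℓ)
    ends zero    = _
    ends (suc c) = end≡ (c * ℓ)
    s+2<ℓ : 2 + s < ℓ
    s+2<ℓ = ≤-trans (m≤m+n (3 + s) (3 * i)) (≤-reflexive (trans (go s (3 * i)) ℓ≡)) where
      go : ∀ s q → 3 + s + q ≡ s + (1 + (1 + (1 + q)))
      go = solve-∀
    joined-< : ∀ c → All (λ q → proj₁ q < c * ℓ) (joined (prevAt t i c) s)
    joined-< zero    = []
    joined-< (suc c) = ≤-trans (+-monoʳ-< (c * ℓ) s+2<ℓ) (≤-reflexive (+-comm (c * ℓ) ℓ)) ∷ []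
    joined-old : ∀ {a n} → x ≤ a → (a , n) ∈ joined pv s ++ H → (a , n) ∈ H
    joined-old x≤a m with ∈-++⁻ (joined pv s) m
    ... | inj₁ m′ = ⊥-elim (<⇒≱ (All.lookup (joined-< c) m′) x≤a)
    ... | inj₂ m′ = m′
    t≤k : t ≤ k
    t≤k = ≤-trans (m≤m+n t i) (≤-reflexive e)
    max : ∀ {n} → (x , n) ∈ H → n ≤ s + (1 + (1 + (d + r′))) → n ≤ s
    max m n≤ with top b m
    ... | inj₁ n≤s = n≤s
    ... | inj₂ M≤  = ⊥-elim (<⇒≱ (s≤s (≤-trans (+-monoʳ-≤ x n≤) (≤-reflexive (trans (cong (x +_) (sym r≡)) all≡)))) M≤)
    deep : Depth L x (s + (1 + (1 + (d + r′)))) (ℓ + r′)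
    deep = let D , m , q = long b in
      inj₂ (D , m , +-cancelˡ-≤ x _ _ (≤-trans (≤-trans (≤-reflexive all≡) (n≤1+n _)) q) , ≤-reflexive r≡)
    none₀ : ∀ {n} → ¬ (x + s , n) ∈ joined pv s ++ H
    none₀ m = free₀ tl ≤-refl t≤k (joined-old (m≤m+n x s) m)
    none₁ : ∀ {n} → ¬ (z , n) ∈ (x , s + 1) ∷ joined pv s ++ H
    none₁ (here q)  = m+1+n≢m x (cong proj₁ q)
    none₁ (there m) = free₁ tl ≤-refl t≤k (joined-old (m≤m+n x (1 + s)) m)
    bound : ∀ {n} → (x + (2 + s) , n) ∈ (x + s , 1 + 1) ∷ (x , s + 1) ∷ joined pv s ++ H → n ≤ d
    bound (here q)          = ⊥-elim (<⇒≢ (n≤1+n (suc s)) (sym (+-cancelˡ-≡ x _ _ (cong proj₁ q))))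
    bound (there (here q))  = ⊥-elim (m+1+n≢m x (cong proj₁ q))
    bound (there (there m)) = right tl e ≤-refl (joined-old (m≤m+n x (2 + s)) m)
    near : ∀ {q} → q ≤ 2 → x + (q + s) < x + 3 * suc t
    near {q} q≤2 = +-monoʳ-< x (≤-trans (+-monoˡ-≤ s (s≤s q≤2)) (≤-reflexive (sym (*-suc 3 t))))
    new : Block (1 + s) (1 + t) x (A ++ H) (A′ ++ L)
    new = record
      { top = tp
      ; topKnown = inj₂ (there (here (cong (x ,_) (+-comm 1 s))))
      ; long = let D , m , q = long b in D , there (there m) , q
      ; tail = tail-frame A A′
          (inj₁ (near (s≤s z≤n)) ∷ inj₁ (near z≤n) ∷ inj₁ (≤-trans (s≤s (m≤m+n x s)) (near z≤n)) ∷
            All.map (λ a< → inj₁ (≤-trans a< (m≤m+n x _))) (joined-< c))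
          (tail-narrow (n≤1+n t) tl)
      }
      where
      tp : ∀ {n} → (x , n) ∈ A ++ H → n ≤ 1 + s ⊎ M ≤ x + n
      tp (here q)                 = ⊥-elim (m+1+n≢m x (sym (cong proj₁ q)))
      tp (there (here q))         = ⊥-elim (<⇒≢ (m<m+n x 0<s) (cong proj₁ q))
      tp (there (there (here refl))) = inj₁ (≤-reflexive (+-comm s 1))
      tp (there (there (there m))) = map₁ m≤n⇒m≤1+n (top b (joined-old ≤-refl m))
    offl : ∀ d → d < c → All (λ i → Off (1 + t) (d * ℓ) (proj₁ i)) A
    offl d d<c = far (1 + s) ∷ far s ∷ off-right {1 + t} (block-end d<c) ∷ offj c d<c
      where
      far : ∀ q → Off (1 + t) (d * ℓ) (x + q)
      far q = off-right {1 + t} (≤-trans (block-end d<c) (m≤m+n x q))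
      offj : ∀ c → d < c → All (λ i → Off (1 + t) (d * ℓ) (proj₁ i)) (joined (prevAt t i c) s)
      offj (suc c) (s≤s d≤c) with m≤n⇒m<n∨m≡n d≤c
      ... | inj₁ d<c  = off-right {1 + t} (≤-trans (block-end d<c) (m≤m+n (c * ℓ) _)) ∷ []
      -- The pair across the block border starts at offset `2 + 3 * t` of block `d`, just left of
      -- the positions used from stage `1 + t` on.
      ... | inj₂ refl = (m+1+n≢m (c * ℓ) , inj₁ (+-monoʳ-< (c * ℓ) (≤-reflexive (sym (*-suc 3 t))))) ∷ []
    offr : All (λ q → proj₁ q < x + ℓ) A
    offr = +-monoʳ-< x (≤-trans (n≤1+n _) s+2<ℓ) ∷ +-monoʳ-< x (≤-trans (≤-trans (n≤1+n _) (n≤1+n _)) s+2<ℓ) ∷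
           m<m+n x (s≤s z≤n) ∷ All.map (λ a< → ≤-trans a< (m≤m+n x ℓ)) (joined-< c)

  stageLength : ℕ
  stageLength = k * (ℓ + 2) + (k * (ℓ + 2) + (k * ℓ + 2))

  -- After `t` stages the short factors have length `1 + 3 * t`; two sweeps of `preset` bring them
  -- to `3 * (1 + t)`, and the copy of u adds one more letter.
  stages : ∀ j t → t + j ≡ k → ∀ {H L} → Blocks (1 + 3 * t) (1 + t) H L →
           Goal H L (j * stageLength + k) (j * (tri k * ℓ))
  stages zero    t e bl = goal-end
  stages (suc j) t e bl =
    goal-mono (≤-reflexive (lens j (k * (ℓ + 2)) (k * ℓ) k))
      (preset (1 + 3 * t) (1 + t) (s≤s z≤n) (s≤s z≤n) (fits (s≤s (s≤s z≤n)))
        (λ bl₁ → preset (2 + 3 * t) (1 + t) (s≤s z≤n) (s≤s z≤n) (fits (s≤s (s≤s (s≤s z≤n))))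
          (λ {H} {L} bl₂ → midway-start 0 (k * ℓ)
            (probe (1 + t) j (s≤s z≤n) e′ (stages j (suc t) e′) k 0 refl
              (mixed-start (subst (λ s → Blocks s (1 + t) H L) (sym (*-suc 3 t)) bl₂))))
          k 0 refl (mixed-start bl₁))
        k 0 refl (mixed-start bl))
    where
    e′ = trans (sym (+-suc t j)) e
    lens : ∀ j p q n → p + (p + (q + (2 + (j * (p + (p + (q + 2))) + n)))) ≡ suc j * (p + (p + (q + 2))) + n
    lens = solve-∀
    fits : ∀ {i} → i ≤ 3 → i + 3 * t ≤ ℓ
    fits i≤3 = +-mono-≤ i≤3 (*-monoʳ-≤ 3 (≤-trans (m≤m+n t (suc j)) (≤-reflexive e)))

  -- Total length and cost, and the exponent.

  totalLength totalCost : ℕ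
  totalLength = k * setupLength + (k * stageLength + k)
  totalCost   = k * (tri k * ℓ)

  expensive : ∃[ w ] (k ≤ length w × length w ≤ totalLength × totalCost ≤ lzdCost w × totalCost ≤ lzmwCost w)
  expensive with setup (stages k 0 refl) k ≤-refl {[]} {[]} start M
    where
    start : Ready k [] []
    start = record
      -- No block is set up yet; the suffix of u$ at `k * ℓ` is the letter $, whence `D = 1`.
      { blocks = λ d k≤d d<k → ⊥-elim (<⇒≱ d<k k≤d) ; starts = λ () ; D = 1 ; knownD = inj₁ refl
      ; D≡ = +-comm (k * ℓ) 1 }
  ... | w , k≤ , ≤n , K =
    w , k≤ , ≤n , Costs.lzd K (length w) [] ≤-refl empty , Costs.lzmw K (length w) [] nothing ≤-refl empty (inj₁ refl)
    where
    empty : Models [] [] [] M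
    empty = record { M≤σ = ≤-refl ; below = λ () ; upper = λ () ; lower = λ () }

  j²≤2tri : ∀ j → j * j ≤ 2 * tri j
  j²≤2tri zero    = z≤n
  j²≤2tri (suc j) = ≤-trans (≤-reflexive (sq j)) (≤-trans (+-monoʳ-≤ (1 + 2 * j) (j²≤2tri j))
                      (≤-trans (n≤1+n _) (≤-reflexive (dist j (tri j)))))
    where
    sq : ∀ j → suc j * suc j ≡ 1 + 2 * j + j * j
    sq = solve-∀
    dist : ∀ j q → 1 + (1 + 2 * j + 2 * q) ≡ 2 * (suc j + q)
    dist = solve-∀

  -- The factor 2 lost in `tri k` is regained from `ℓ`, which is at least `2 * k`.
  k⁴≤totalCost : k ^ 4 ≤ totalCost
  k⁴≤totalCost = ≤-trans (≤-reflexive (pow k)) (*-monoʳ-≤ k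
    (≤-trans (*-monoˡ-≤ k (j²≤2tri k)) (≤-trans (≤-reflexive (reorder (tri k) k))
      (*-monoʳ-≤ (tri k) (≤-trans (*-monoˡ-≤ k (n≤1+n 2)) (m≤n+m (3 * k) 3))))))
    where
    pow : ∀ k → k * (k * (k * (k * 1))) ≡ k * (k * k * k)
    pow = solve-∀
    reorder : ∀ q k → 2 * q * k ≡ q * (2 * k)
    reorder = solve-∀

totalLength≤75k³ : ∀ j → Schedule.totalLength (suc j) ≤ 75 * suc j ^ 3
totalLength≤75k³ j = m+n≤o⇒m≤o _ (≤-reflexive (difference j))
  where
  -- The length is 24 k³ + 37 k² + 14 k, and k³ - k² and k³ - k are nonnegative polynomials in j = k - 1.
  difference : ∀ j → let k = suc j ; l = 3 + 3 * k ; m = suc (k * l) in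
    k * (k * (3 * (l + 2)) + ((l + 2) + ((m + 2) + (m + 2)))) + (k * (k * (l + 2) + (k * (l + 2) + (k * l + 2))) + k)
      + (37 * (j * (k * k)) + 14 * (k * (j * (2 + j))))
    ≡ 75 * (k * (k * (k * 1)))
  difference = solve-∀

^-distribʳ-* : ∀ p m n → (m * n) ^ p ≡ m ^ p * n ^ p
^-distribʳ-* zero    m n = refl
^-distribʳ-* (suc p) m n = trans (cong (m * n *_) (^-distribʳ-* p m n)) ([m*n]*[o*p]≡[m*o]*[n*p] m n (m ^ p) (n ^ p))

omegaN54 : ∀ q (time : Word → ℕ) →
  (∀ N → ∃[ w ] (suc N ≤ length w × length w ≤ q * suc N ^ 3 × suc N ^ 4 ≤ time w)) → OmegaN54 time
omegaN54 q time family = q ^ 5 , bound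
  where
  open ≤-Reasoning
  bound : ∀ N → ∃[ s ] (N ≤ length s × length s ^ 5 ≤ q ^ 5 * time s ^ 4)
  bound N with family N
  ... | s , N< , ≤n , c≤ = s , <⇒≤ N< , (begin
    length s ^ 5             ≤⟨ ^-monoˡ-≤ 5 ≤n ⟩
    (q * suc N ^ 3) ^ 5      ≡⟨ ^-distribʳ-* 5 q (suc N ^ 3) ⟩
    q ^ 5 * (suc N ^ 3) ^ 5  ≡⟨ cong (q ^ 5 *_) (^-*-assoc (suc N) 3 5) ⟩
    -- Length of order K³ and cost K⁴ mean exponent 4/3; passing to 5/4 gives away one factor
    -- `suc N`.
    q ^ 5 * suc N ^ 15       ≤⟨ *-monoʳ-≤ (q ^ 5) (^-monoʳ-≤ (suc N) (n≤1+n 15)) ⟩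
    q ^ 5 * suc N ^ 16       ≡⟨ cong (q ^ 5 *_) (^-*-assoc (suc N) 4 4) ⟨
    q ^ 5 * (suc N ^ 4) ^ 4  ≤⟨ *-monoʳ-≤ (q ^ 5) (^-monoˡ-≤ 4 c≤) ⟩
    q ^ 5 * time s ^ 4       ∎)

theorem3 : OmegaN54 lzdCost × OmegaN54 lzmwCost
theorem3 =
  omegaN54 75 lzdCost  (λ N → let w , k≤ , ≤n , d≤ , _ = Schedule.expensive (suc N) in
    w , k≤ , ≤-trans ≤n (totalLength≤75k³ N) , ≤-trans (Schedule.k⁴≤totalCost (suc N)) d≤) ,
  omegaN54 75 lzmwCost (λ N → let w , k≤ , ≤n , _ , m≤ = Schedule.expensive (suc N) in
    w , k≤ , ≤-trans ≤n (totalLength≤75k³ N) , ≤-trans (Schedule.k⁴≤totalCost (suc N)) m≤)
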